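{- For every integer $n \geq 1$, the polynomial $f(6n,q)$ is divisible by $2(1+q)(1+q^2)$ (in $\mathbb{Z}[q]$).
   Context: For an indeterminate $q$ let $[n]_q = \frac{1-q^n}{1-q} = 1+q+\cdots+q^{n-1}$ and let $\begin{bmatrix} n \\ k \end{bmatrix} = \frac{[n]_q [n-1]_q\cdots[n-k+1]_q}{[1]_q[2]_q\cdots[k]_q}$ be the $q$-binomial coefficient (a polynomial in $q$ with integer coefficients). The $q$-Fibonacci numbers $f(n,q)$ are the polynomials in $\mathbb{Z}[q]$ $$f(n,q) = \sum_{k=0}^{\lfloor (n-1)/2 \rfloor} q^{\binom{k}{2}} \begin{bmatrix} n-1-k \\ k \end{bmatrix}.$$ -}

module Defs where

open import Algebra.Bundles using (CommutativeRing; Semiring)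
import Algebra.Definitions.RawMagma as RawMagmaDefs
import Algebra.Definitions.RawSemiring as RawSemiringDefs
import Algebra.Properties.Semiring.Sum as SemiringSum
import Algebra.Properties.CommutativeSemigroup as CommutativeSemigroupProperties
open import Data.Fin using (Fin; zero; suc; toℕ)
open import Data.Integer as ℤ using (ℤ; +_)
import Data.Integer.Properties as ℤₚ
open import Data.List using (List; []; _∷_; map)
open import Data.Nat as ℕ using (ℕ; zero; suc; _∸_; s≤s)
import Data.Nat.Properties as ℕₚ
open import Data.Nat.Combinatorics using (_C_)
open import Data.Nat.DivMod using (_/_)
open import Data.Product using (_,_)
open import Data.Vec.Functional using (Vector)
open import Level using (0ℓ)
open import Relation.Binary.PropositionalEquality as ≡ using (_≡_)
open import Relation.Binary.Structures using (IsEquivalence)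
open import Relation.Nullary using (yes; no)
import Relation.Binary.Reasoning.Setoid as SetoidReasoning

-- a₀ ∷ a₁ ∷ … represents a₀ + a₁ q + …; trailing zeros are allowed, so the
-- equality of ℤ[q] is _≈ₚ_ and not _≡_.
Poly : Set
Poly = List ℤ

coeff : Poly → ℕ → ℤ
coeff []      _       = + 0
coeff (a ∷ _) zero    = a
coeff (_ ∷ p) (suc i) = coeff p i

infix 4 _≈ₚ_
record _≈ₚ_ (p r : Poly) : Set where
  constructor mk≈
  field
    coeff≡ : ∀ i → coeff p i ≡ coeff r i
open _≈ₚ_

infixl 6 _+ₚ_
infixl 7 _*ₚ_ _·ₚ_

_+ₚ_ : Poly → Poly → Poly
[]      +ₚ r       = r
(a ∷ p) +ₚ []      = a ∷ p
(a ∷ p) +ₚ (b ∷ r) = a ℤ.+ b ∷ p +ₚ r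

_·ₚ_ : ℤ → Poly → Poly
a ·ₚ p = map (a ℤ.*_) p

-ₚ_ : Poly → Poly
-ₚ p = map ℤ.-_ p

_*ₚ_ : Poly → Poly → Poly
[]      *ₚ r = []
(a ∷ p) *ₚ r = a ·ₚ r +ₚ (+ 0 ∷ p *ₚ r)

private
  ≈-refl : ∀ {p} → p ≈ₚ p
  ≈-refl = mk≈ λ _ → ≡.refl

  ≈-sym : ∀ {p r} → p ≈ₚ r → r ≈ₚ p
  ≈-sym e = mk≈ λ i → ≡.sym (coeff≡ e i)

  ≈-trans : ∀ {p r s} → p ≈ₚ r → r ≈ₚ s → p ≈ₚ s
  ≈-trans e f = mk≈ λ i → ≡.trans (coeff≡ e i) (coeff≡ f i)

  ≈-isEquivalence : IsEquivalence _≈ₚ_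
  ≈-isEquivalence = record { refl = ≈-refl ; sym = ≈-sym ; trans = ≈-trans }

  coeff-+ : ∀ p r i → coeff (p +ₚ r) i ≡ coeff p i ℤ.+ coeff r i
  coeff-+ []      r       i       = ≡.sym (ℤₚ.+-identityˡ _)
  coeff-+ (a ∷ p) []      i       = ≡.sym (ℤₚ.+-identityʳ _)
  coeff-+ (a ∷ p) (b ∷ r) zero    = ≡.refl
  coeff-+ (a ∷ p) (b ∷ r) (suc i) = coeff-+ p r i

  coeff-· : ∀ a p i → coeff (a ·ₚ p) i ≡ a ℤ.* coeff p i
  coeff-· a []      i       = ≡.sym (ℤₚ.*-zeroʳ a)
  coeff-· a (b ∷ p) zero    = ≡.refl
  coeff-· a (b ∷ p) (suc i) = coeff-· a p i

  coeff-neg : ∀ p i → coeff (-ₚ p) i ≡ ℤ.- coeff p i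
  coeff-neg []      i       = ≡.refl
  coeff-neg (b ∷ p) zero    = ≡.refl
  coeff-neg (b ∷ p) (suc i) = coeff-neg p i

  ∷-cong : ∀ {a b p r} → a ≡ b → p ≈ₚ r → (a ∷ p) ≈ₚ (b ∷ r)
  ∷-cong a≡b e = mk≈ λ { zero → a≡b ; (suc i) → coeff≡ e i }

  +-cong : ∀ {p p′ r r′} → p ≈ₚ p′ → r ≈ₚ r′ → p +ₚ r ≈ₚ p′ +ₚ r′
  +-cong {p} {p′} {r} {r′} e f = mk≈ λ i →
    ≡.trans (coeff-+ p r i)
      (≡.trans (≡.cong₂ ℤ._+_ (coeff≡ e i) (coeff≡ f i)) (≡.sym (coeff-+ p′ r′ i)))

  +-assoc : ∀ p r s → (p +ₚ r) +ₚ s ≈ₚ p +ₚ (r +ₚ s)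
  +-assoc p r s = mk≈ λ i → begin
    coeff ((p +ₚ r) +ₚ s) i                     ≡⟨ coeff-+ (p +ₚ r) s i ⟩
    coeff (p +ₚ r) i ℤ.+ coeff s i              ≡⟨ ≡.cong (ℤ._+ _) (coeff-+ p r i) ⟩
    (coeff p i ℤ.+ coeff r i) ℤ.+ coeff s i     ≡⟨ ℤₚ.+-assoc (coeff p i) _ _ ⟩
    coeff p i ℤ.+ (coeff r i ℤ.+ coeff s i)     ≡⟨ ≡.cong (ℤ._+_ (coeff p i)) (coeff-+ r s i) ⟨
    coeff p i ℤ.+ coeff (r +ₚ s) i              ≡⟨ coeff-+ p (r +ₚ s) i ⟨
    coeff (p +ₚ (r +ₚ s)) i                     ∎
    where open ≡.≡-Reasoning

  +-comm : ∀ p r → p +ₚ r ≈ₚ r +ₚ p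
  +-comm p r = mk≈ λ i →
    ≡.trans (coeff-+ p r i)
      (≡.trans (ℤₚ.+-comm (coeff p i) _) (≡.sym (coeff-+ r p i)))

  +-identityʳ : ∀ p → p +ₚ [] ≈ₚ p
  +-identityʳ p = +-comm p []

  +-inverseˡ : ∀ p → (-ₚ p) +ₚ p ≈ₚ []
  +-inverseˡ p = mk≈ λ i →
    ≡.trans (coeff-+ (-ₚ p) p i)
      (≡.trans (≡.cong (ℤ._+ coeff p i) (coeff-neg p i)) (ℤₚ.+-inverseˡ (coeff p i)))

  neg-cong : ∀ {p r} → p ≈ₚ r → -ₚ p ≈ₚ -ₚ r
  neg-cong {p} {r} e = mk≈ λ i →
    ≡.trans (coeff-neg p i) (≡.trans (≡.cong ℤ.-_ (coeff≡ e i)) (≡.sym (coeff-neg r i)))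

  ·-cong : ∀ a {p r} → p ≈ₚ r → a ·ₚ p ≈ₚ a ·ₚ r
  ·-cong a {p} {r} e = mk≈ λ i →
    ≡.trans (coeff-· a p i) (≡.trans (≡.cong (a ℤ.*_) (coeff≡ e i)) (≡.sym (coeff-· a r i)))

  ·-distribʳ : ∀ a b p → (a ℤ.+ b) ·ₚ p ≈ₚ a ·ₚ p +ₚ b ·ₚ p
  ·-distribʳ a b p = mk≈ λ i → begin
    coeff ((a ℤ.+ b) ·ₚ p) i                    ≡⟨ coeff-· (a ℤ.+ b) p i ⟩
    (a ℤ.+ b) ℤ.* coeff p i                     ≡⟨ ℤₚ.*-distribʳ-+ (coeff p i) a b ⟩
    a ℤ.* coeff p i ℤ.+ b ℤ.* coeff p i         ≡⟨ ≡.cong₂ ℤ._+_ (coeff-· a p i) (coeff-· b p i) ⟨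
    coeff (a ·ₚ p) i ℤ.+ coeff (b ·ₚ p) i       ≡⟨ coeff-+ (a ·ₚ p) (b ·ₚ p) i ⟨
    coeff (a ·ₚ p +ₚ b ·ₚ p) i                  ∎
    where open ≡.≡-Reasoning

  ·-distribˡ : ∀ a p r → a ·ₚ (p +ₚ r) ≈ₚ a ·ₚ p +ₚ a ·ₚ r
  ·-distribˡ a p r = mk≈ λ i → begin
    coeff (a ·ₚ (p +ₚ r)) i                     ≡⟨ coeff-· a (p +ₚ r) i ⟩
    a ℤ.* coeff (p +ₚ r) i                      ≡⟨ ≡.cong (a ℤ.*_) (coeff-+ p r i) ⟩
    a ℤ.* (coeff p i ℤ.+ coeff r i)             ≡⟨ ℤₚ.*-distribˡ-+ a (coeff p i) _ ⟩
    a ℤ.* coeff p i ℤ.+ a ℤ.* coeff r i         ≡⟨ ≡.cong₂ ℤ._+_ (coeff-· a p i) (coeff-· a r i) ⟨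
    coeff (a ·ₚ p) i ℤ.+ coeff (a ·ₚ r) i       ≡⟨ coeff-+ (a ·ₚ p) (a ·ₚ r) i ⟨
    coeff (a ·ₚ p +ₚ a ·ₚ r) i                  ∎
    where open ≡.≡-Reasoning

  ·-assoc : ∀ a b p → (a ℤ.* b) ·ₚ p ≈ₚ a ·ₚ (b ·ₚ p)
  ·-assoc a b p = mk≈ λ i → begin
    coeff ((a ℤ.* b) ·ₚ p) i      ≡⟨ coeff-· (a ℤ.* b) p i ⟩
    (a ℤ.* b) ℤ.* coeff p i       ≡⟨ ℤₚ.*-assoc a b _ ⟩
    a ℤ.* (b ℤ.* coeff p i)       ≡⟨ ≡.cong (a ℤ.*_) (coeff-· b p i) ⟨
    a ℤ.* coeff (b ·ₚ p) i        ≡⟨ coeff-· a (b ·ₚ p) i ⟨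
    coeff (a ·ₚ (b ·ₚ p)) i       ∎
    where open ≡.≡-Reasoning

  ·-identity : ∀ p → (+ 1) ·ₚ p ≈ₚ p
  ·-identity p = mk≈ λ i → ≡.trans (coeff-· (+ 1) p i) (ℤₚ.*-identityˡ _)

  ·-zero : ∀ p → (+ 0) ·ₚ p ≈ₚ []
  ·-zero p = mk≈ λ i → ≡.trans (coeff-· (+ 0) p i) (ℤₚ.*-zeroˡ (coeff p i))

  0∷[] : (+ 0 ∷ []) ≈ₚ []
  0∷[] = mk≈ λ { zero → ≡.refl ; (suc _) → ≡.refl }

  +-interchange : ∀ p r s t → (p +ₚ r) +ₚ (s +ₚ t) ≈ₚ (p +ₚ s) +ₚ (r +ₚ t)
  +-interchange p r s t =
    ≈-trans (+-assoc p r (s +ₚ t))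
    (≈-trans (+-cong (≈-refl {p})
       (≈-trans (≈-sym (+-assoc r s t))
       (≈-trans (+-cong (+-comm r s) ≈-refl) (+-assoc s r t))))
    (≈-sym (+-assoc p s (r +ₚ t))))

  *-congˡ : ∀ p {r s} → r ≈ₚ s → p *ₚ r ≈ₚ p *ₚ s
  *-congˡ []      e = ≈-refl
  *-congˡ (a ∷ p) e = +-cong (·-cong a e) (∷-cong ≡.refl (*-congˡ p e))

  *-zeroʳ : ∀ p → p *ₚ [] ≈ₚ []
  *-zeroʳ []      = ≈-refl
  *-zeroʳ (a ∷ p) = ≈-trans (∷-cong ≡.refl (*-zeroʳ p)) 0∷[]

  *-∷ʳ : ∀ p b r → p *ₚ (b ∷ r) ≈ₚ b ·ₚ p +ₚ (+ 0 ∷ p *ₚ r)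
  *-∷ʳ []      b r = ≈-sym 0∷[]
  *-∷ʳ (a ∷ p) b r = ∷-cong (≡.cong (ℤ._+ + 0) (ℤₚ.*-comm a b))
    (≈-trans (+-cong (≈-refl {a ·ₚ r}) (*-∷ʳ p b r))
    (≈-trans (≈-sym (+-assoc (a ·ₚ r) (b ·ₚ p) _))
    (≈-trans (+-cong (+-comm (a ·ₚ r) (b ·ₚ p)) ≈-refl)
             (+-assoc (b ·ₚ p) (a ·ₚ r) _))))

  *-comm : ∀ p r → p *ₚ r ≈ₚ r *ₚ p
  *-comm []      r = ≈-sym (*-zeroʳ r)
  *-comm (a ∷ p) r =
    ≈-trans (+-cong (≈-refl {a ·ₚ r}) (∷-cong ≡.refl (*-comm p r))) (≈-sym (*-∷ʳ r a p))

  *-cong : ∀ {p p′ r r′} → p ≈ₚ p′ → r ≈ₚ r′ → p *ₚ r ≈ₚ p′ *ₚ r′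
  *-cong {p} {p′} {r} {r′} e f =
    ≈-trans (*-congˡ p f)
    (≈-trans (*-comm p r′) (≈-trans (*-congˡ r′ e) (*-comm r′ p′)))

  *-distribˡ : ∀ p r s → p *ₚ (r +ₚ s) ≈ₚ p *ₚ r +ₚ p *ₚ s
  *-distribˡ []      r s = ≈-refl
  *-distribˡ (a ∷ p) r s =
    ≈-trans (+-cong (·-distribˡ a r s) (∷-cong ≡.refl (*-distribˡ p r s)))
            (+-interchange (a ·ₚ r) (a ·ₚ s) (+ 0 ∷ p *ₚ r) (+ 0 ∷ p *ₚ s))

  *-distribʳ : ∀ p r s → (r +ₚ s) *ₚ p ≈ₚ r *ₚ p +ₚ s *ₚ p
  *-distribʳ p r s =
    ≈-trans (*-comm (r +ₚ s) p)
    (≈-trans (*-distribˡ p r s) (+-cong (*-comm p r) (*-comm p s)))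

  ·-*-assoc : ∀ a p r → (a ·ₚ p) *ₚ r ≈ₚ a ·ₚ (p *ₚ r)
  ·-*-assoc a []      r = ≈-refl
  ·-*-assoc a (b ∷ p) r =
    ≈-trans (+-cong (·-assoc a b r)
                    (∷-cong (≡.sym (ℤₚ.*-zeroʳ a)) (·-*-assoc a p r)))
            (≈-sym (·-distribˡ a (b ·ₚ r) (+ 0 ∷ p *ₚ r)))

  *-assoc : ∀ p r s → (p *ₚ r) *ₚ s ≈ₚ p *ₚ (r *ₚ s)
  *-assoc []      r s = ≈-refl
  *-assoc (a ∷ p) r s =
    ≈-trans (*-distribʳ s (a ·ₚ r) (+ 0 ∷ p *ₚ r))
    (+-cong (·-*-assoc a r s)
       (≈-trans (+-cong (·-zero s) ≈-refl) (∷-cong ≡.refl (*-assoc p r s))))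

  *-identityˡ : ∀ p → (+ 1 ∷ []) *ₚ p ≈ₚ p
  *-identityˡ p = ≈-trans (+-cong (·-identity p) 0∷[]) (+-identityʳ p)

ℤ[q] : CommutativeRing 0ℓ 0ℓ
ℤ[q] = record
  { Carrier = Poly
  ; _≈_     = _≈ₚ_
  ; _+_     = _+ₚ_
  ; _*_     = _*ₚ_
  ; -_      = -ₚ_
  ; 0#      = []
  ; 1#      = + 1 ∷ []
  ; isCommutativeRing = record
    { isRing = record
      { +-isAbelianGroup = record
        { isGroup = record
          { isMonoid = record
            { isSemigroup = record
              { isMagma = record { isEquivalence = ≈-isEquivalence ; ∙-cong = +-cong }
              ; assoc = +-assoc
              }
            ; identity = (λ _ → ≈-refl) , +-identityʳ
            }
          ; inverse = +-inverseˡ , λ p → ≈-trans (+-comm p (-ₚ p)) (+-inverseˡ p)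
          ; ⁻¹-cong = neg-cong
          }
        ; comm = +-comm
        }
      ; *-cong = *-cong
      ; *-assoc = *-assoc
      ; *-identity = *-identityˡ , λ p → ≈-trans (*-comm p _) (*-identityˡ p)
      ; distrib = *-distribˡ , *-distribʳ
      }
    ; *-comm = *-comm
    }
  }

open CommutativeRing ℤ[q] public using (_≈_; _+_; _*_; _-_; 0#; 1#)
open RawSemiringDefs (Semiring.rawSemiring (CommutativeRing.semiring ℤ[q])) public using (_^_; _∣_; product)
open SemiringSum (CommutativeRing.semiring ℤ[q]) public using (sum; sum-syntax; sum⁺-syntax)

infixl 10 product-syntax
product-syntax : ∀ n → Vector Poly n → Poly
product-syntax _ = product

syntax product-syntax n (λ i → x) = ∏[ i < n ] x

const : ℤ → Poly
const a = a ∷ []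

q : Poly
q = + 0 ∷ + 1 ∷ []

[_]q : ℕ → Poly
[ n ]q = ∑[ i < n ] (q ^ toℕ i)

-- [n]_q [n-1]_q ⋯ [n-k+1]_q.  For k > n the truncated subtraction is harmless:
-- the product then contains [0]_q = 0.
numerator : ℕ → ℕ → Poly
numerator n k = ∏[ i < k ] [ n ∸ toℕ i ]q

denominator : ℕ → Poly
denominator k = ∏[ i < k ] [ suc (toℕ i) ]q

private
  module R = CommutativeRing ℤ[q]
  module ⋆ = CommutativeSemigroupProperties R.*-commutativeSemigroup
  module Σₚ = SemiringSum R.semiring
  open SetoidReasoning R.setoid

  []q-suc : ∀ n → [ suc n ]q ≈ 1# + q * [ n ]q
  []q-suc n = R.+-congˡ {1#} (R.sym (Σₚ.*-distribˡ-sum q (λ (i : Fin n) → q ^ toℕ i)))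

  []q-+ : ∀ m n → [ m ℕ.+ n ]q ≈ [ m ]q + q ^ m * [ n ]q
  []q-+ zero    n = R.sym (R.*-identityˡ [ n ]q)
  []q-+ (suc m) n = begin
    [ suc (m ℕ.+ n) ]q                          ≈⟨ []q-suc (m ℕ.+ n) ⟩
    1# + q * [ m ℕ.+ n ]q                       ≈⟨ R.+-congˡ {1#} (R.*-congˡ {q} ([]q-+ m n)) ⟩
    1# + q * ([ m ]q + q ^ m * [ n ]q)          ≈⟨ R.+-congˡ {1#} (R.distribˡ q [ m ]q (q ^ m * [ n ]q)) ⟩
    1# + (q * [ m ]q + q * (q ^ m * [ n ]q))    ≈⟨ R.+-assoc 1# (q * [ m ]q) (q * (q ^ m * [ n ]q)) ⟨
    (1# + q * [ m ]q) + q * (q ^ m * [ n ]q)    ≈⟨ R.+-cong (R.sym ([]q-suc m)) (R.sym (R.*-assoc q (q ^ m) [ n ]q)) ⟩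
    [ suc m ]q + q ^ suc m * [ n ]q             ∎

  product-last : ∀ k (g : ℕ → Poly) →
                 ∏[ i < suc k ] g (toℕ i) ≈ (∏[ i < k ] g (toℕ i)) * g k
  product-last zero    g = R.*-comm (g 0) 1#
  product-last (suc k) g =
    R.trans (R.*-congˡ {g 0} (product-last k (λ i → g (suc i))))
            (R.sym (R.*-assoc (g 0) (∏[ i < k ] g (suc (toℕ i))) (g (suc k))))

  pascal : ℕ → ℕ → Poly
  pascal n       zero    = 1#
  pascal zero    (suc k) = 0#
  pascal (suc n) (suc k) = pascal n k + q ^ suc k * pascal n (suc k)

  numerator-zero : ∀ {n k} → n ℕ.< k → numerator n k ≈ 0#
  numerator-zero {zero}  {suc k} _         = R.zeroˡ (∏[ i < k ] [ 0 ∸ suc (toℕ i) ]q)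
  numerator-zero {suc n} {suc k} (s≤s n<k) =
    R.trans (R.*-congˡ {[ suc n ]q} (numerator-zero n<k)) (R.zeroʳ [ suc n ]q)

  numerator-step : ∀ n k →
    numerator n k * ([ suc k ]q + q ^ suc k * [ n ∸ k ]q) ≈ [ suc n ]q * numerator n k
  numerator-step n k with k ℕ.≤? n
  ... | yes k≤n = R.trans (R.*-congˡ {numerator n k} (R.sym
          (R.trans (R.reflexive (≡.cong (λ m → [ suc m ]q) (≡.sym (ℕₚ.m+[n∸m]≡n k≤n))))
                   ([]q-+ (suc k) (n ∸ k)))))
          (R.*-comm (numerator n k) [ suc n ]q)
  ... | no k≰n = begin
    numerator n k * X            ≈⟨ R.*-congʳ {X} z ⟩
    0# * X                       ≈⟨ R.zeroˡ X ⟩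
    0#                           ≈⟨ R.zeroʳ [ suc n ]q ⟨
    [ suc n ]q * 0#              ≈⟨ R.*-congˡ {[ suc n ]q} z ⟨
    [ suc n ]q * numerator n k   ∎
    where
    X = [ suc k ]q + q ^ suc k * [ n ∸ k ]q
    z = numerator-zero (ℕₚ.≰⇒> k≰n)

  pascal-denominator : ∀ n k → pascal n k * denominator k ≈ numerator n k
  pascal-denominator n       zero    = R.*-identityˡ 1#
  pascal-denominator zero    (suc k) = R.sym (R.zeroˡ (numerator 0 k))
  pascal-denominator (suc n) (suc k) = begin
    (B + Q * B′) * D′             ≈⟨ R.distribʳ D′ B (Q * B′) ⟩
    B * D′ + Q * B′ * D′          ≈⟨ R.+-cong left right ⟩
    N * K + N * (Q * [ n ∸ k ]q)  ≈⟨ R.distribˡ N K (Q * [ n ∸ k ]q) ⟨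
    N * (K + Q * [ n ∸ k ]q)      ≈⟨ numerator-step n k ⟩
    [ suc n ]q * N                ∎
    where
    B = pascal n k
    B′ = pascal n (suc k)
    D = denominator k
    D′ = denominator (suc k)
    N = numerator n k
    K = [ suc k ]q
    Q = q ^ suc k
    left : B * D′ ≈ N * K
    left = begin
      B * D′       ≈⟨ R.*-congˡ {B} (product-last k (λ i → [ suc i ]q)) ⟩
      B * (D * K)  ≈⟨ R.*-assoc B D K ⟨
      B * D * K    ≈⟨ R.*-congʳ {K} (pascal-denominator n k) ⟩
      N * K        ∎
    right : Q * B′ * D′ ≈ N * (Q * [ n ∸ k ]q)
    right = begin
      Q * B′ * D′             ≈⟨ R.*-assoc Q B′ D′ ⟩
      Q * (B′ * D′)           ≈⟨ R.*-congˡ {Q} (pascal-denominator n (suc k)) ⟩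
      Q * numerator n (suc k) ≈⟨ R.*-congˡ {Q} (product-last k (λ i → [ n ∸ i ]q)) ⟩
      Q * (N * [ n ∸ k ]q)    ≈⟨ ⋆.x∙yz≈y∙xz Q N [ n ∸ k ]q ⟩
      N * (Q * [ n ∸ k ]q)    ∎

denominator∣numerator : ∀ n k → denominator k ∣ numerator n k
denominator∣numerator n k = record
  { quotient = pascal n k ; equality = pascal-denominator n k }

-- The quotient numerator / denominator in ℤ[q]; it is unique up to _≈_ by
-- qBinomial-unique below, so its value does not depend on the divisibility proof.
qBinomial : ℕ → ℕ → Poly
qBinomial n k = RawMagmaDefs._∣ʳ_.quotient (denominator∣numerator n k)

qBinomial-spec : ∀ n k → qBinomial n k * denominator k ≈ numerator n k
qBinomial-spec n k = RawMagmaDefs._∣ʳ_.equality (denominator∣numerator n k)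

private
  coeff₀-* : ∀ p r → coeff (p * r) 0 ≡ coeff p 0 ℤ.* coeff r 0
  coeff₀-* []      r = ≡.refl
  coeff₀-* (a ∷ p) r =
    ≡.trans (coeff-+ (a ·ₚ r) (+ 0 ∷ p * r) 0)
    (≡.trans (ℤₚ.+-identityʳ _) (coeff-· a r 0))

  coeff₀-[]q : ∀ n → coeff [ suc n ]q 0 ≡ + 1
  coeff₀-[]q n =
    ≡.trans (coeff≡ ([]q-suc n) 0)
    (≡.trans (coeff-+ 1# (q * [ n ]q) 0)
             (≡.cong (ℤ._+_ (+ 1)) (≡.trans (coeff₀-* q [ n ]q) (ℤₚ.*-zeroˡ (coeff [ n ]q 0)))))

  coeff₀-denominator : ∀ k → coeff (denominator k) 0 ≡ + 1
  coeff₀-denominator zero    = ≡.refl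
  coeff₀-denominator (suc k) =
    ≡.trans (coeff≡ (product-last k (λ i → [ suc i ]q)) 0)
    (≡.trans (coeff₀-* (denominator k) _)
             (≡.cong₂ ℤ._*_ (coeff₀-denominator k) (coeff₀-[]q k)))

  cancel₀ : ∀ d → coeff d 0 ≡ + 1 → ∀ p → p * d ≈ 0# → p ≈ 0#
  cancel₀ d d₀ []      _ = R.refl
  cancel₀ d d₀ (a ∷ p) e = R.trans (∷-cong a≡0 (cancel₀ d d₀ p p*d≈0)) 0∷[]
    where
    a≡0 : a ≡ + 0
    a≡0 = ≡.trans (≡.sym (≡.trans (≡.cong (a ℤ.*_) d₀) (ℤₚ.*-identityʳ a)))
            (≡.trans (≡.sym (coeff₀-* (a ∷ p) d)) (coeff≡ e 0))
    shifted : (+ 0 ∷ p * d) ≈ 0#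
    shifted = R.trans (R.sym (+-cong (R.trans (R.reflexive (≡.cong (_·ₚ d) a≡0)) (·-zero d)) R.refl)) e
    p*d≈0 : p * d ≈ 0#
    p*d≈0 = mk≈ λ i → coeff≡ shifted (suc i)

qBinomial-unique : ∀ n k r → r * denominator k ≈ numerator n k → r ≈ qBinomial n k
qBinomial-unique n k r e = R.trans
  (R.sym (R.trans (R.+-assoc r (R.- B) B)
         (R.trans (R.+-congˡ {r} (R.-‿inverseˡ B)) (R.+-identityʳ r))))
  (R.+-congʳ {B} (cancel₀ (denominator k) (coeff₀-denominator k) (r - B) diff))
  where
  B = qBinomial n k
  D = denominator k
  diff : (r - B) * D ≈ 0#
  diff = begin
    (r - B) * D                ≈⟨ R.distribʳ D r (R.- B) ⟩
    r * D + (R.- B) * D        ≈⟨ R.+-congʳ {(R.- B) * D} (R.trans e (R.sym (qBinomial-spec n k))) ⟩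
    B * D + (R.- B) * D        ≈⟨ R.distribʳ D B (R.- B) ⟨
    (B - B) * D                ≈⟨ R.*-congʳ {D} (R.-‿inverseʳ B) ⟩
    0# * D                     ≈⟨ R.zeroˡ D ⟩
    0#                         ∎

-- The q-Fibonacci polynomial f(n,q), for n ≥ 1.  Every subtraction is then
-- exact, since k ≤ ⌊(n-1)/2⌋ gives k ≤ n-1.
f : ℕ → Poly
f n = ∑[ k ≤ (n ∸ 1) / 2 ] (q ^ (toℕ k C 2) * qBinomial (n ∸ 1 ∸ toℕ k) (toℕ k))

{-# OPTIONS --safe #-}
module Submission where

open import Algebra.Bundles using (CommutativeRing; CommutativeSemiring)
import Algebra.Definitions.RawSemiring as RawSemiringDefs
import Algebra.Properties.CommutativeSemigroup as CommutativeSemigroupProperties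
import Algebra.Properties.Semiring.Exp as SemiringExp
import Algebra.Properties.Semiring.Sum as SemiringSum
import Algebra.Solver.Ring.NaturalCoefficients.Default as SemiringSolver
open import Data.Fin using (toℕ)
open import Data.Integer as ℤ using (ℤ)
import Data.Integer.Properties as ℤₚ
open import Data.Integer.Tactic.RingSolver using (solve-∀)
open import Data.List using ([]; _∷_)
open import Data.Nat as ℕ using (ℕ; zero; suc; _∸_; _<_; s≤s)
open import Data.Nat.Combinatorics using (_C_; nCk+nC[k+1]≡[n+1]C[k+1]; nC1≡n)
open import Data.Nat.DivMod using (_/_; m≡m%n+[m/n]*n; m%n<n)
import Data.Nat.Properties as ℕₚ
open import Data.Product using (_×_; _,_; ∃-syntax)
open import Relation.Binary.PropositionalEquality as ≡ using (_≡_; refl; cong; cong₂)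
import Relation.Binary.Reasoning.Setoid as SetoidReasoning
open import Relation.Nullary using (yes; no)

-- F n s = Σₖ q^(k choose 2) [n-1-k choose k] sᵏ satisfies, by the q-Pascal
-- rule, F (n+2) s = F (n+1) (q s) + s F n (q s), and then by induction
-- F (n+2) (q s) = F (n+1) (q s) + s qⁿ F n s.  At s = 1 they combine to
-- F (n+3) 1 = 2 F (n+1) q + qⁿ F n 1, so F n 1 = 2 H n whenever 3 ∣ n, where
-- H (n+3) = F (n+1) q + qⁿ H n.  Modulo (1 + q)(1 + q²) we have q⁴ = 1, and all
-- these sequences are multiplied by q² when n grows by 12; since H 0 and H 6
-- vanish there, so does every H (6m).
module QFibonacci {c ℓ} (R : CommutativeSemiring c ℓ) (q : CommutativeSemiring.Carrier R) where
  open CommutativeSemiring R renaming (refl to ≈-refl; sym to ≈-sym; trans to ≈-trans)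
  open RawSemiringDefs rawSemiring using (_^_)
  open SemiringExp semiring using (^-homo-*)
  open SemiringSum semiring using (sum-syntax; sum-cong-≋; sum-replicate-zero; *-distribˡ-sum; ∑-distrib-+)
  open SemiringSolver R
  open SetoidReasoning setoid

  -- Recursive q-Fibonacci polynomials with a parameter `s`.

  F : ℕ → Carrier → Carrier
  F zero          s = 0#
  F (suc zero)    s = 1#
  F (suc (suc n)) s = F (suc n) (q * s) + s * F n (q * s)

  -- H n is half of a n only for n divisible by 3; H 1 = H 2 = 0 is arbitrary.
  a b H : ℕ → Carrier
  a n = F n 1#
  b n = F n (q * 1#)
  H (suc (suc (suc n))) = b (suc n) + q ^ n * H n
  H _ = 0#

  -- Unlike the defining recurrence, this one lowers the index at the fixed argument `q * s`. After
  -- unfolding, the hypotheses for `n + 1` and `n` are taken at `q * s`; the terms carrying `q ^ n`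
  -- regroup into `F (2 + n) s`.
  F-dual : ∀ n s → F (suc (suc n)) (q * s) ≈ F (suc n) (q * s) + s * (q ^ n * F n s)
  F-dual zero s =
    solve 2 (λ q s → con 1 :+ q :* s :* con 0 := con 1 :+ s :* (con 1 :* con 0)) ≈-refl q s
  F-dual (suc zero) s =
    solve 2 (λ q s → con 1 :+ q :* (q :* s) :* con 0 :+ q :* s :* con 1 :=
                     con 1 :+ q :* s :* con 0 :+ s :* (q :* con 1 :* con 1)) ≈-refl q s
  F-dual (suc (suc n)) s = begin
    F (3 ℕ.+ n) q²s + q * s * F (2 ℕ.+ n) q²s
      ≈⟨ +-cong (F-dual (suc n) (q * s)) (*-congˡ (F-dual n (q * s))) ⟩
    F (2 ℕ.+ n) q²s + q * s * (q * q ^ n * x) + q * s * (F (1 ℕ.+ n) q²s + q * s * (q ^ n * y))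
      ≈⟨ solve 7 (λ q s Q u v x y →
           u :+ q :* s :* (q :* Q :* x) :+ q :* s :* (v :+ q :* s :* (Q :* y)) :=
           u :+ q :* s :* v :+ s :* (q :* (q :* Q) :* (x :+ s :* y)))
         ≈-refl q s (q ^ n) (F (2 ℕ.+ n) q²s) (F (1 ℕ.+ n) q²s) x y ⟩
    F (2 ℕ.+ n) q²s + q * s * F (1 ℕ.+ n) q²s + s * (q * (q * q ^ n) * (x + s * y)) ∎
    where
    q²s = q * (q * s)
    x = F (suc n) (q * s)
    y = F n (q * s)

  -- The explicit sum, for any array `B` obeying the q-Pascal rule.

  module Explicit
    (B : ℕ → ℕ → Carrier)
    (B-zeroʳ : ∀ n → B n 0 ≈ 1#)
    (B-zeroˡ : ∀ k → B 0 (suc k) ≈ 0#)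
    (B-suc : ∀ n k → B (suc n) (suc k) ≈ B n k + q ^ suc k * B n (suc k))
    where

    -- For `k > m` both truncated differences are 0 and all entries involved lie in row 0 and a
    -- positive column, so both sides vanish.
    B-diagonal-suc : ∀ m k → B (suc m ∸ k) (suc k) ≈ B (m ∸ k) k + q ^ suc k * B (m ∸ k) (suc k)
    B-diagonal-suc m k with k ℕ.≤? m
    ... | yes k≤m = ≈-trans (reflexive (cong (λ i → B i (suc k)) (ℕₚ.+-∸-assoc 1 k≤m))) (B-suc (m ∸ k) k)
    ... | no  k≰m = begin
      B (suc m ∸ k) (suc k)    ≈⟨ reflexive (cong (λ i → B i (suc k)) (ℕₚ.m≤n⇒m∸n≡0 m<k)) ⟩
      B 0 (suc k)              ≈⟨ B-zeroˡ k ⟩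
      0#                       ≈⟨ zeroʳ (q ^ suc k) ⟨
      q ^ suc k * 0#           ≈⟨ +-identityˡ _ ⟨
      0# + q ^ suc k * 0#      ≈⟨ +-cong (B0k m<k) (*-congˡ (B-zeroˡ k)) ⟨
      B 0 k + q ^ suc k * B 0 (suc k)
        ≈⟨ reflexive (cong (λ i → B i k + q ^ suc k * B i (suc k)) (ℕₚ.m≤n⇒m∸n≡0 (ℕₚ.<⇒≤ m<k))) ⟨
      B (m ∸ k) k + q ^ suc k * B (m ∸ k) (suc k) ∎
      where
      m<k = ℕₚ.≰⇒> k≰m
      B0k : ∀ {m k} → m < k → B 0 k ≈ 0#
      B0k {k = suc k} _ = B-zeroˡ k

    term : ℕ → Carrier → ℕ → Carrier
    term n s k = s ^ k * (q ^ (k C 2) * B (n ∸ k) k)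

    -- q-Pascal splits the left side in two. The `q ^ k` from C(k+1, 2) = k + C(k, 2) turns `s ^ k`
    -- into `(q * s) ^ k` in one part; in the other, the Pascal factor `q ^ suc k` does the same for
    -- `s ^ suc k`.
    term-suc : ∀ m s k →
      term (2 ℕ.+ m) s (suc k) ≈ term (1 ℕ.+ m) (q * s) (suc k) + s * term m (q * s) k
    term-suc m s k = begin
      s * s ^ k * (q ^ (suc k C 2) * B (suc m ∸ k) (suc k))
        ≈⟨ *-congˡ (*-cong qC (B-diagonal-suc m k)) ⟩
      s * s ^ k * (q ^ k * Q * (x + q * q ^ k * y))
        ≈⟨ solve 7 (λ q s S K Q x y →
             s :* S :* (K :* Q :* (x :+ q :* K :* y)) :=
             q :* s :* (K :* S) :* (K :* Q :* y) :+ s :* (K :* S :* (Q :* x)))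
           ≈-refl q s (s ^ k) (q ^ k) Q x y ⟩
      q * s * (q ^ k * s ^ k) * (q ^ k * Q * y) + s * (q ^ k * s ^ k * (Q * x))
        ≈⟨ +-cong (*-cong (*-congˡ (^-distrib-* k)) (*-congʳ qC)) (*-congˡ (*-congʳ (^-distrib-* k))) ⟨
      q * s * (q * s) ^ k * (q ^ (suc k C 2) * y) + s * ((q * s) ^ k * (Q * x)) ∎
      where
      x = B (m ∸ k) k
      y = B (m ∸ k) (suc k)
      Q = q ^ (k C 2)
      qC : q ^ (suc k C 2) ≈ q ^ k * Q
      qC = ≈-trans
        (reflexive (cong (q ^_) (≡.trans (≡.sym (nCk+nC[k+1]≡[n+1]C[k+1] k 1)) (cong (ℕ._+ k C 2) (nC1≡n k)))))
        (^-homo-* q k (k C 2))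
      ^-distrib-* : ∀ k → (q * s) ^ k ≈ q ^ k * s ^ k
      ^-distrib-* zero    = ≈-sym (*-identityˡ 1#)
      ^-distrib-* (suc k) = ≈-trans (*-congˡ (^-distrib-* k))
        (solve 4 (λ q s Q S → q :* s :* (Q :* S) := q :* Q :* (s :* S)) ≈-refl q s (q ^ k) (s ^ k))

    term-zero : ∀ n s → term n s 0 ≈ 1#
    term-zero n s = ≈-trans (*-identityˡ _) (≈-trans (*-identityˡ _) (B-zeroʳ n))

    sum-vanishing : ∀ N n s → (∀ k → B (n ∸ suc k) (suc k) ≈ 0#) →
                    ∑[ k < suc N ] term n s (toℕ k) ≈ 1#
    sum-vanishing N n s B≈0 = ≈-trans
      (+-cong (term-zero n s) (≈-trans
        (sum-cong-≋ {N} λ k → ≈-trans (*-congˡ (≈-trans (*-congˡ (B≈0 (toℕ k))) (zeroʳ _))) (zeroʳ _))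
        (sum-replicate-zero N)))
      (+-identityʳ 1#)

    -- Terms with k > n/2 vanish, so `N` may be any large enough bound. This freedom lets the
    -- induction take `suc N` terms for `suc n` but `N` for `n`; with the term at 0 split off, the
    -- sums match index by index.
    F≈sum : ∀ N n s → n < N ℕ.* 2 → F (suc n) s ≈ ∑[ k < N ] term n s (toℕ k)
    F≈sum (suc N) zero s _ = ≈-sym (sum-vanishing N 0 s B-zeroˡ)
    F≈sum (suc N) (suc zero) s _ =
      ≈-trans (≈-trans (+-congˡ (zeroʳ s)) (+-identityʳ 1#))
        (≈-sym (sum-vanishing N 1 s λ k →
          ≈-trans (reflexive (cong (λ i → B i (suc k)) (ℕₚ.0∸n≡0 k))) (B-zeroˡ k)))
    F≈sum (suc N) (suc (suc n)) s (s≤s (s≤s n<2N)) = begin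
      F (2 ℕ.+ n) (q * s) + s * F (1 ℕ.+ n) (q * s)
        ≈⟨ +-cong (F≈sum (suc N) (suc n) (q * s) (s≤s (ℕₚ.m<n⇒m<1+n n<2N)))
                  (*-congˡ (F≈sum N n (q * s) n<2N)) ⟩
      term (1 ℕ.+ n) (q * s) 0 + ∑[ k < N ] u (toℕ k) + s * ∑[ k < N ] v (toℕ k)
        ≈⟨ +-assoc _ _ _ ⟩
      term (1 ℕ.+ n) (q * s) 0 + (∑[ k < N ] u (toℕ k) + s * ∑[ k < N ] v (toℕ k))
        ≈⟨ +-cong (≈-trans (term-zero (1 ℕ.+ n) (q * s)) (≈-sym (term-zero (2 ℕ.+ n) s))) tail ⟩
      term (2 ℕ.+ n) s 0 + ∑[ k < N ] term (2 ℕ.+ n) s (suc (toℕ k)) ∎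
      where
      u v : ℕ → Carrier
      u k = term (1 ℕ.+ n) (q * s) (suc k)
      v k = term n (q * s) k
      tail : ∑[ k < N ] u (toℕ k) + s * ∑[ k < N ] v (toℕ k) ≈
             ∑[ k < N ] term (2 ℕ.+ n) s (suc (toℕ k))
      tail = begin
        ∑[ k < N ] u (toℕ k) + s * ∑[ k < N ] v (toℕ k)
          ≈⟨ +-congˡ (*-distribˡ-sum {N} s (λ k → v (toℕ k))) ⟩
        ∑[ k < N ] u (toℕ k) + ∑[ k < N ] (s * v (toℕ k))
          ≈⟨ ∑-distrib-+ {N} (λ k → u (toℕ k)) (λ k → s * v (toℕ k)) ⟨
        ∑[ k < N ] (u (toℕ k) + s * v (toℕ k))
          ≈⟨ sum-cong-≋ {N} (λ k → term-suc n s (toℕ k)) ⟨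
        ∑[ k < N ] term (2 ℕ.+ n) s (suc (toℕ k)) ∎

    a≈sum : ∀ N n → n < N ℕ.* 2 → a (suc n) ≈ ∑[ k < N ] (q ^ (toℕ k C 2) * B (n ∸ toℕ k) (toℕ k))
    a≈sum N n n<2N = ≈-trans (F≈sum N n 1# n<2N) (sum-cong-≋ {N} λ k → 1^k*x≈x (toℕ k) _)
      where
      1^k*x≈x : ∀ k x → 1# ^ k * x ≈ x
      1^k*x≈x zero    x = *-identityˡ x
      1^k*x≈x (suc k) x = ≈-trans (*-congʳ (*-identityˡ (1# ^ k))) (1^k*x≈x k x)

  -- Specialisation to `s = 1` and the factor 2.

  a-rec : ∀ n → a (2 ℕ.+ n) ≈ b (1 ℕ.+ n) + b n
  a-rec n = +-congˡ (*-identityˡ (b n))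

  b-rec : ∀ n → b (2 ℕ.+ n) ≈ b (1 ℕ.+ n) + q ^ n * a n
  b-rec n = ≈-trans (F-dual n 1#) (+-congˡ (*-identityˡ _))

  -- Having an explicit half, rather than mere evenness, lets the factor 2 be multiplied with
  -- `modulus` at the end.
  a≈2H : ∀ m → a (m ℕ.* 3) ≈ (1# + 1#) * H (m ℕ.* 3)
  a≈2H zero    = ≈-sym (zeroʳ _)
  a≈2H (suc m) = begin
    a (3 ℕ.+ n)                               ≈⟨ a-rec (suc n) ⟩
    b (2 ℕ.+ n) + b (1 ℕ.+ n)                 ≈⟨ +-congʳ (b-rec n) ⟩
    b (1 ℕ.+ n) + q ^ n * a n + b (1 ℕ.+ n)   ≈⟨ +-congʳ (+-congˡ (*-congˡ (a≈2H m))) ⟩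
    b (1 ℕ.+ n) + q ^ n * ((1# + 1#) * H n) + b (1 ℕ.+ n)
      ≈⟨ solve 3 (λ x Q h → x :+ Q :* ((con 1 :+ con 1) :* h) :+ x :=
                            (con 1 :+ con 1) :* (x :+ Q :* h)) ≈-refl (b (1 ℕ.+ n)) (q ^ n) (H n) ⟩
    (1# + 1#) * (b (1 ℕ.+ n) + q ^ n * H n)   ∎
    where n = m ℕ.* 3

  modulus : Carrier
  modulus = (1# + q) * (1# + q ^ 2)

  -- One Horner step of division by `modulus` = 1 + q + q² + q³. The incoming coefficients are
  -- written w + z, x + z, y + z, because a semiring has no subtraction.
  division-step : ∀ t w x y z →
    w + z + q * (t * modulus + (x + z + q * (y + z + q * z))) ≈
    (z + q * t) * modulus + (w + q * (x + q * y))
  division-step = solve 6 (λ q t w x y z →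
    let d = (con 1 :+ q) :* (con 1 :+ q :* (q :* con 1)) in
    w :+ z :+ q :* (t :* d :+ (x :+ z :+ q :* (y :+ z :+ q :* z))) :=
    (z :+ q :* t) :* d :+ (w :+ q :* (x :+ q :* y))) ≈-refl q

open import Defs
open import Data.Nat as ℕ using (ℕ; _≥_)
open import Data.Integer using (+_)

private
  module ℤ[q]ᴿ = CommutativeRing ℤ[q]
  module ⋆ = CommutativeSemigroupProperties ℤ[q]ᴿ.*-commutativeSemigroup
  module E = SetoidReasoning ℤ[q]ᴿ.setoid
open QFibonacci ℤ[q]ᴿ.commutativeSemiring q
open _≈ₚ_
-- `qBinomial n k` unfolds to the quotient constructed by the q-Pascal rule, so all three hypotheses
-- hold by computation.
open Explicit qBinomial (λ _ → ℤ[q]ᴿ.refl) (λ _ → ℤ[q]ᴿ.refl) (λ _ _ → ℤ[q]ᴿ.refl)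

-- Identification with the q-Fibonacci numbers in ℤ[q].

f≈a : ∀ n → f (suc n) ≈ a (suc n)
f≈a n = ℤ[q]ᴿ.sym (a≈sum (suc (n / 2)) n n<)
  where
  n< : n < suc (n / 2) ℕ.* 2
  n< = ≡.subst (_< suc (n / 2) ℕ.* 2) (≡.sym (m≡m%n+[m/n]*n n 2)) (ℕₚ.+-monoˡ-< (n / 2 ℕ.* 2) (m%n<n n 2))

-- Residues modulo (1 + q)(1 + q²).

0∷≈ : ∀ p → + 0 ∷ p ≈ q * p
0∷≈ p = E.begin
  + 0 ∷ p                   E.≈⟨ mk≈ (λ { zero → refl ; (suc i) → ≡.sym (coeff≡ (ℤ[q]ᴿ.*-identityˡ p) i) }) ⟩
  0∷1p                      E.≈⟨ ℤ[q]ᴿ.+-congʳ {0∷1p} (ℤ[q]ᴿ.trans (ℤ[q]ᴿ.*-congʳ {p} 0≈0) (ℤ[q]ᴿ.zeroˡ p)) ⟨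
  const (+ 0) * p + 0∷1p    E.≈⟨ ℤ[q]ᴿ.+-assoc (+ 0 ·ₚ p) (const (+ 0)) 0∷1p ⟩
  q * p                     E.∎
  where
  0∷1p = + 0 ∷ 1# * p
  0≈0 : const (+ 0) ≈ 0#
  0≈0 = mk≈ λ { zero → refl ; (suc _) → refl }

∷≈ : ∀ x p → x ∷ p ≈ const x + q * p
∷≈ x p = ℤ[q]ᴿ.trans
  (ℤ[q]ᴿ.reflexive (cong (_∷ p) (≡.sym (ℤₚ.+-identityʳ x))))
  (ℤ[q]ᴿ.+-congˡ {const x} (0∷≈ p))

-- (x , y , z) stands for the residue x + y q + z q² modulo (1 + q)(1 + q²),
-- where q³ = - 1 - q - q².
Residue : Set
Residue = ℤ × ℤ × ℤ

infixl 6 _⊕_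
_⊕_ : Residue → Residue → Residue
(x , y , z) ⊕ (x′ , y′ , z′) = x ℤ.+ x′ , y ℤ.+ y′ , z ℤ.+ z′

const+q· : ℤ → Residue → Residue
const+q· c (x , y , z) = c ℤ.- z , x ℤ.- z , y ℤ.- z

0ᴿ : Residue
0ᴿ = + 0 , + 0 , + 0

rem : Poly → Residue
rem []      = 0ᴿ
rem (c ∷ p) = const+q· c (rem p)

infixr 7 q·_ q^_·_
q·_ : Residue → Residue
q· r = const+q· (+ 0) r

-- Reduces the exponent modulo 4, as q⁴ = 1 modulo (1 + q)(1 + q²).
q^_·_ : ℕ → Residue → Residue
q^ 0 · r = r
q^ 1 · r = q· r
q^ 2 · r = q· q· r
q^ 3 · r = q· q· q· r
q^ suc (suc (suc (suc n))) · r = q^ n · r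

≡³ : ∀ {x x′ y y′ z z′ : ℤ} → x ≡ x′ → y ≡ y′ → z ≡ z′ → (x , y , z) ≡ (x′ , y′ , z′)
≡³ refl refl refl = refl

q·q·-expand : ∀ x y z → q· q· (x , y , z) ≡ (z ℤ.- y , + 0 ℤ.- y , x ℤ.- y)
q·q·-expand x y z = ≡³ (e₀ y z) (e₁ (+ 0) y z) (e₁ x y z)
  where
  e₀ : ∀ y z → + 0 ℤ.- (y ℤ.- z) ≡ z ℤ.- y
  e₀ = solve-∀
  e₁ : ∀ x y z → x ℤ.- z ℤ.- (y ℤ.- z) ≡ x ℤ.- y
  e₁ = solve-∀

q·q·q·q·r≡r : ∀ r → q· q· q· q· r ≡ r
q·q·q·q·r≡r (x , y , z) = ≡.trans (cong (λ r → q· q· r) (q·q·-expand x y z))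
  (≡.trans (q·q·-expand (z ℤ.- y) (+ 0 ℤ.- y) (x ℤ.- y)) (≡³ (e₀ x y) (e₁ y) (e₀ z y)))
  where
  e₀ : ∀ x y → x ℤ.- y ℤ.- (+ 0 ℤ.- y) ≡ x
  e₀ = solve-∀
  e₁ : ∀ y → + 0 ℤ.- (+ 0 ℤ.- y) ≡ y
  e₁ = solve-∀

q·q^n·r≡q^[1+n]·r : ∀ n r → q· q^ n · r ≡ q^ suc n · r
q·q^n·r≡q^[1+n]·r 0 r = refl
q·q^n·r≡q^[1+n]·r 1 r = refl
q·q^n·r≡q^[1+n]·r 2 r = refl
q·q^n·r≡q^[1+n]·r 3 r = q·q·q·q·r≡r r
q·q^n·r≡q^[1+n]·r (suc (suc (suc (suc n)))) r = q·q^n·r≡q^[1+n]·r n r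

const+q·-⊕ : ∀ c d u v → const+q· (c ℤ.+ d) (u ⊕ v) ≡ const+q· c u ⊕ const+q· d v
const+q·-⊕ c d (x , y , z) (x′ , y′ , z′) = ≡³ (e c d z z′) (e x x′ z z′) (e y y′ z z′)
  where
  e : ∀ x x′ z z′ → x ℤ.+ x′ ℤ.- (z ℤ.+ z′) ≡ x ℤ.- z ℤ.+ (x′ ℤ.- z′)
  e = solve-∀

rem-+ : ∀ p r → rem (p + r) ≡ rem p ⊕ rem r
rem-+ []      r       = ≡.sym (≡³ (ℤₚ.+-identityˡ _) (ℤₚ.+-identityˡ _) (ℤₚ.+-identityˡ _))
rem-+ (c ∷ p) []      = ≡.sym (≡³ (ℤₚ.+-identityʳ _) (ℤₚ.+-identityʳ _) (ℤₚ.+-identityʳ _))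
rem-+ (c ∷ p) (d ∷ r) = ≡.trans (cong (const+q· (c ℤ.+ d)) (rem-+ p r)) (const+q·-⊕ c d (rem p) (rem r))

-- Trailing zeros are harmless since `const+q· (+ 0) 0ᴿ` computes to `0ᴿ`; the two mixed cases rest
-- on this.
rem-cong : ∀ {p r} → p ≈ r → rem p ≡ rem r
rem-cong {[]}    {[]}    _ = refl
rem-cong {[]}    {d ∷ r} e = cong₂ const+q· (coeff≡ e 0) (rem-cong {[]} {r} (mk≈ λ i → coeff≡ e (suc i)))
rem-cong {c ∷ p} {[]}    e = cong₂ const+q· (coeff≡ e 0) (rem-cong {p} {[]} (mk≈ λ i → coeff≡ e (suc i)))
rem-cong {c ∷ p} {d ∷ r} e = cong₂ const+q· (coeff≡ e 0) (rem-cong {p} {r} (mk≈ λ i → coeff≡ e (suc i)))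

rem-q^ : ∀ n p → rem (q ^ n * p) ≡ q^ n · rem p
rem-q^ zero    p = rem-cong (ℤ[q]ᴿ.*-identityˡ p)
rem-q^ (suc n) p = ≡.trans
  (rem-cong (ℤ[q]ᴿ.trans (ℤ[q]ᴿ.*-assoc q (q ^ n) p) (ℤ[q]ᴿ.sym (0∷≈ (q ^ n * p)))))
  (≡.trans (cong q·_ (rem-q^ n p)) (q·q^n·r≡q^[1+n]·r n (rem p)))

rem-+-q^ : ∀ {t} p n r → t ≈ p + q ^ n * r → rem t ≡ rem p ⊕ q^ n · rem r
rem-+-q^ p n r e = ≡.trans (rem-cong e) (≡.trans (rem-+ p (q ^ n * r)) (cong (rem p ⊕_) (rem-q^ n r)))

toPoly : Residue → Poly
toPoly (x , y , z) = const x + q * (const y + q * const z)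

-- Ties the computed residue to the ring: a polynomial whose residue is 0 is a multiple of
-- `modulus`.
division : ∀ p → ∃[ t ] p ≈ t * modulus + toPoly (rem p)
division []      = [] , mk≈ λ { 0 → refl ; 1 → refl ; 2 → refl ; (suc (suc (suc _))) → refl }
division (c ∷ p) with rem p | division p
... | x , y , z | t , p≈ = const z + q * t , (E.begin
  c ∷ p                                       E.≈⟨ ∷≈ c p ⟩
  const c + q * p                             E.≈⟨ ℤ[q]ᴿ.+-congˡ {const c} (ℤ[q]ᴿ.*-congˡ {q} p≈) ⟩
  const c + q * (t * modulus + (const x + q * (const y + q * Z)))
    -- Each coefficient v becomes (v - z) + z, the form that `division-step` takes.
    E.≈⟨ ℤ[q]ᴿ.reflexive (cong₂ (λ u v → u + q * v) (split c)
         (cong₂ (λ u v → t * modulus + (u + q * (v + q * Z))) (split x) (split y))) ⟩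
  W + Z + q * (t * modulus + (X + Z + q * (Y + Z + q * Z)))
    E.≈⟨ division-step t W X Y Z ⟩
  (Z + q * t) * modulus + (W + q * (X + q * Y)) E.∎)
  where
  Z = const z
  W = const (c ℤ.- z)
  X = const (x ℤ.- z)
  Y = const (y ℤ.- z)
  split : ∀ w → const w ≡ const (w ℤ.- z) + const z
  split w = cong const (e w z)
    where
    e : ∀ w z → w ≡ w ℤ.- z ℤ.+ z
    e = solve-∀

-- Periodicity of the residues.

-- A window wide enough for the recurrences, which reach back two places for `a` and `b` and three
-- for `H`.
record State : Set where
  no-eta-equality
  pattern
  constructor ⟨_,_,_,_,_,_,_⟩
  field
    b₀ b₁ a₀ a₁ H₀ H₁ H₂ : Residue

step : ℕ → State → State
step n ⟨ b₀ , b₁ , a₀ , a₁ , H₀ , H₁ , H₂ ⟩ =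
  ⟨ b₁ , b₁ ⊕ q^ n · a₀ , a₁ , b₁ ⊕ b₀ , H₁ , H₂ , b₁ ⊕ q^ n · H₀ ⟩

residues : ℕ → State
residues n = ⟨ rem (b n) , rem (b (1 ℕ.+ n)) , rem (a n) , rem (a (1 ℕ.+ n))
             , rem (H n) , rem (H (1 ℕ.+ n)) , rem (H (2 ℕ.+ n)) ⟩

residues-suc : ∀ n → residues (suc n) ≡ step n (residues n)
residues-suc n = next
  (rem-+-q^ (b (suc n)) n (a n) (b-rec n))
  (≡.trans (rem-cong (a-rec n)) (rem-+ (b (suc n)) (b n)))
  (rem-+-q^ (b (suc n)) n (H n) ℤ[q]ᴿ.refl)
  where
  next : ∀ {b₁ b₂ b₂′ a₁ a₂ a₂′ H₁ H₂ H₃ H₃′} → b₂ ≡ b₂′ → a₂ ≡ a₂′ → H₃ ≡ H₃′ →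
         ⟨ b₁ , b₂ , a₁ , a₂ , H₁ , H₂ , H₃ ⟩ ≡ ⟨ b₁ , b₂′ , a₁ , a₂′ , H₁ , H₂ , H₃′ ⟩
  next refl refl refl = refl

run : ℕ → State → State
run zero    s = s
run (suc n) s = step n (run n s)

-- The states at n = 0 and n = 12; multiplication by q² sends each to the other.
initial middle : State
initial = ⟨ 0ᴿ , 1ᴿ , 0ᴿ , 1ᴿ , 0ᴿ , 0ᴿ , 0ᴿ ⟩
  where 1ᴿ = + 1 , + 0 , + 0
middle = ⟨ 0ᴿ , q²ᴿ , 0ᴿ , q²ᴿ , 0ᴿ , 0ᴿ , 0ᴿ ⟩
  where q²ᴿ = + 0 , + 0 , + 1

residues≡run : ∀ n → residues n ≡ run n initial
residues≡run zero    = refl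
residues≡run (suc n) = ≡.trans (residues-suc n) (cong (step n) (residues≡run n))

-- 12 is a multiple of 4, the period of `q^_·_` in its exponent.
step-12+ : ∀ n s → step (12 ℕ.+ n) s ≡ step n s
step-12+ n ⟨ _ , _ , _ , _ , _ , _ , _ ⟩ = refl

run-12+ : ∀ n {s t} → run 12 s ≡ t → run (12 ℕ.+ n) s ≡ run n t
run-12+ zero    e = e
run-12+ (suc n) e = ≡.trans (cong (step (12 ℕ.+ n)) (run-12+ n e)) (step-12+ n _)

-- Mutual induction in steps of 2: twelve steps exchange `initial` and `middle`, which `refl` checks
-- by evaluation, as it does the values after 0 and 6 steps.
H₀-initial : ∀ m → State.H₀ (run (m ℕ.* 6) initial) ≡ 0ᴿ
H₀-middle  : ∀ m → State.H₀ (run (m ℕ.* 6) middle) ≡ 0ᴿ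
H₀-initial 0             = refl
H₀-initial 1             = refl
H₀-initial (suc (suc m)) =
  ≡.trans (cong State.H₀ (run-12+ (m ℕ.* 6) {initial} {middle} refl)) (H₀-middle m)
H₀-middle 0             = refl
H₀-middle 1             = refl
H₀-middle (suc (suc m)) =
  ≡.trans (cong State.H₀ (run-12+ (m ℕ.* 6) {middle} {initial} refl)) (H₀-initial m)

-- Divisibility of `f (6n)`.

modulus∣H : ∀ m → ∃[ t ] H (m ℕ.* 6) ≈ t * modulus
modulus∣H m with division (H (m ℕ.* 6))
... | t , e = t , ℤ[q]ᴿ.trans e (ℤ[q]ᴿ.trans (ℤ[q]ᴿ.+-congˡ {t * modulus} rem≈0) (ℤ[q]ᴿ.+-identityʳ _))
  where
  rem≈0 : toPoly (rem (H (m ℕ.* 6))) ≈ 0#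
  rem≈0 = ℤ[q]ᴿ.trans
    (ℤ[q]ᴿ.reflexive (cong toPoly (≡.trans (cong State.H₀ (residues≡run (m ℕ.* 6))) (H₀-initial m))))
    (mk≈ λ { 0 → refl ; 1 → refl ; 2 → refl ; (suc (suc (suc _))) → refl })

-- The bound `n ≥ 1` matters: truncated subtraction makes `f 0` equal to 1, while `a 0` is 0.
f≈2H : ∀ {n} m → n ≥ 1 → n ≡ m ℕ.* 3 → f n ≈ const (+ 2) * H (m ℕ.* 3)
f≈2H {suc n} m _ n≡3m = ℤ[q]ᴿ.trans (f≈a n) (ℤ[q]ᴿ.trans (ℤ[q]ᴿ.reflexive (cong a n≡3m)) (a≈2H m))

mainTheorem2 : ∀ (n : ℕ) → n ≥ 1 → const (+ 2) * (1# + q) * (1# + q ^ 2) ∣ f (6 ℕ.* n)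
mainTheorem2 n n≥1 with modulus∣H n
... | t , H≈ = record { quotient = t ; equality = E.begin
  t * (const (+ 2) * (1# + q) * (1# + q ^ 2))
    E.≈⟨ ℤ[q]ᴿ.*-congˡ {t} (ℤ[q]ᴿ.*-assoc (const (+ 2)) (1# + q) (1# + q ^ 2)) ⟩
  t * (const (+ 2) * modulus)          E.≈⟨ ⋆.x∙yz≈y∙xz t (const (+ 2)) modulus ⟩
  const (+ 2) * (t * modulus)          E.≈⟨ ℤ[q]ᴿ.*-congˡ {const (+ 2)} H≈ ⟨
  const (+ 2) * H (n ℕ.* 6)
    -- `H` halves `a` at multiples of 3, so `n * 6` is read as `n * 2 * 3`.
    E.≈⟨ ℤ[q]ᴿ.reflexive (cong (λ k → const (+ 2) * H k) (≡.sym (ℕₚ.*-assoc n 2 3))) ⟩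
  const (+ 2) * H (n ℕ.* 2 ℕ.* 3)
    E.≈⟨ f≈2H (n ℕ.* 2) (ℕₚ.≤-trans n≥1 (ℕₚ.m≤m+n n (5 ℕ.* n)))
              (≡.trans (ℕₚ.*-comm 6 n) (≡.sym (ℕₚ.*-assoc n 2 3))) ⟨
  f (6 ℕ.* n)                          E.∎ }
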